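{- Let $(\mathcal{P}_1,\mathcal{L}_1)$ and $(\mathcal{P}_2,\mathcal{L}_2)$ be two $(n_s,m_k)$-configurations with disjoint point sets, and consider a connected sum of them. Then the minimum number of monochromatic triangles over all line $2$-colorings of the connected sum is less than or equal to the sum of the minimum number of monochromatic triangles over all line $2$-colorings of $(\mathcal{P}_1,\mathcal{L}_1)$ and the minimum number of monochromatic triangles over all line $2$-colorings of $(\mathcal{P}_2,\mathcal{L}_2)$.
   Context: An $(n_s,m_k)$-configuration is a pair $(\mathcal{P},\mathcal{L})$ with $\mathcal{P}$ a set of $n\geq 3$ points and $\mathcal{L}$ a set of $m$ subsets of $\mathcal{P}$ called lines, such that any two distinct points lie together on at most one line, every point is on exactly $s$ lines, and every line contains exactly $k$ points. Three points $p_1,p_2,p_3$ form a triangle if there are lines $l_1,l_2,l_3$ with $p_1,p_2\in l_1$, $p_3\notin l_1$; $p_2,p_3\in l_2$, $p_1\notin l_2$; $p_1,p_3\in l_3$, $p_2\notin l_3$; these lines are uniquely determined by the points, and triangles are counted as unordered triples of points. A line $2$-coloring assigns to each line one of the colors red, blue; a triangle is monochromatic if its lines $l_1,l_2,l_3$ all have the same color. A connected sum of two $(n_s,m_k)$-configurations $(\mathcal{P}_1,\mathcal{L}_1)$, $(\mathcal{P}_2,\mathcal{L}_2)$ (with disjoint point sets) is the $(2n_s,2m_k)$-configuration (that is, with $2n$ points and $2m$ lines, $s$ lines per point and $k$ points per line) obtained as follows: choose a point $p_1\in\mathcal{P}_1$ on a line $l_1\in\mathcal{L}_1$ and a point $p_2\in\mathcal{P}_2$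 on a line $l_2\in\mathcal{L}_2$; take the point set $\mathcal{P}_1\cup\mathcal{P}_2$ and the lines $\mathcal{L}_1\cup\mathcal{L}_2$, except that $l_1$ is replaced by $(l_1\setminus\{p_1\})\cup\{p_2\}$ and $l_2$ by $(l_2\setminus\{p_2\})\cup\{p_1\}$. The result may depend on the choices. -}

module Defs where

open import Data.Nat using (ℕ; _+_; _≤_)
open import Data.Fin using (Fin; _<_)
open import Data.Fin.Properties using (any?; _<?_)
open import Data.Fin.Subset
  using (Subset; _∈_; _∉_; _⊆_; _∪_; _-_; ⁅_⁆; ∣_∣)
open import Data.Fin.Subset.Properties using (_∈?_)
open import Data.Vec using (Vec; []; _∷_; _++_; lookup; count; replicate; _[_]≔_)
open import Data.Vec.Relation.Unary.Unique.Propositional using (Unique)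
open import Data.List as List using (List; allFin; cartesianProduct; cartesianProductWith)
open import Data.List.Extrema.Nat using (argmin; f[argmin]≤f[xs])
open import Data.List.Membership.Propositional using () renaming (_∈_ to _∈ˡ_)
open import Data.List.Membership.Propositional.Properties using (∈-cartesianProductWith⁺)
open import Data.List.Relation.Unary.All as All using ()
open import Data.List.Relation.Unary.Any using (here; there)
open import Data.Product using (_×_; _,_; ∃-syntax)
open import Relation.Nullary using (Dec; yes; no; ¬?; _×-dec_)
open import Relation.Unary using (Decidable)
open import Relation.Binary.PropositionalEquality using (_≡_; _≢_; refl)

-- Point sets are subsets of an ambient finite set Fin N, so that disjointness
-- and unions of point sets are literal.  Any two finite sets embed in some
-- Fin N, and nothing depends on N.

record PointLineSystem (N m : ℕ) : Set where
  constructor mkSystem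
  field
    points : Subset N
    lines  : Vec (Subset N) m

  line : Fin m → Subset N
  line = lookup lines

open PointLineSystem public

private
  variable
    N m : ℕ

record IsConfiguration (n s m k : ℕ) (C : PointLineSystem N m) : Set where
  field
    n≥3          : 3 ≤ n
    point-number : ∣ points C ∣ ≡ n
    -- The m entries of the vector are distinct: it enumerates a set of m lines.
    lines-unique : Unique (lines C)
    lines⊆points : ∀ i → line C i ⊆ points C
    linear       : ∀ {p q} → p ≢ q → ∀ {i j} →
                   p ∈ line C i → q ∈ line C i →
                   p ∈ line C j → q ∈ line C j → i ≡ j
    point-degree : ∀ {p} → p ∈ points C → count (p ∈?_) (lines C) ≡ s
    line-size    : ∀ i → ∣ line C i ∣ ≡ k

connectedSum : PointLineSystem N m → Fin N → Fin m →
               PointLineSystem N m → Fin N → Fin m →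
               PointLineSystem N (m + m)
connectedSum C₁ p₁ l₁ C₂ p₂ l₂ = mkSystem
  (points C₁ ∪ points C₂)
  (  (lines C₁ [ l₁ ]≔ ((line C₁ l₁ - p₁) ∪ ⁅ p₂ ⁆))
  ++ (lines C₂ [ l₂ ]≔ ((line C₂ l₂ - p₂) ∪ ⁅ p₁ ⁆)))

data Colour : Set where
  red blue : Colour

_≟ᶜ_ : (a b : Colour) → Dec (a ≡ b)
red  ≟ᶜ red  = yes refl
red  ≟ᶜ blue = no λ ()
blue ≟ᶜ red  = no λ ()
blue ≟ᶜ blue = yes refl

Colouring : ℕ → Set
Colouring m = Vec Colour m

Triple : ℕ → Set
Triple N = Fin N × Fin N × Fin N

module _ (C : PointLineSystem N m) where

  Through : Fin m → Fin N → Fin N → Fin N → Set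
  Through l p q r = p ∈ line C l × q ∈ line C l × r ∉ line C l

  -- The triangle p₁ p₂ p₃, with l₁, l₂, l₃ the lines through
  -- p₁ p₂, p₂ p₃ and p₁ p₃.
  TriangleOn : Triple N → Fin m → Fin m → Fin m → Set
  TriangleOn (p₁ , p₂ , p₃) l₁ l₂ l₃ =
    (p₁ ∈ points C × p₂ ∈ points C × p₃ ∈ points C) ×
    Through l₁ p₁ p₂ p₃ × Through l₂ p₂ p₃ p₁ × Through l₃ p₁ p₃ p₂

  Monochromatic : Colouring m → Triple N → Set
  Monochromatic c t =
    ∃[ l₁ ] ∃[ l₂ ] ∃[ l₃ ] TriangleOn t l₁ l₂ l₃ ×
      (lookup c l₁ ≡ lookup c l₂ × lookup c l₂ ≡ lookup c l₃)

  through? : ∀ l p q r → Dec (Through l p q r)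
  through? l p q r =
    (p ∈? line C l) ×-dec (q ∈? line C l) ×-dec ¬? (r ∈? line C l)

  triangleOn? : ∀ t l₁ l₂ l₃ → Dec (TriangleOn t l₁ l₂ l₃)
  triangleOn? (p₁ , p₂ , p₃) l₁ l₂ l₃ =
    ((p₁ ∈? points C) ×-dec (p₂ ∈? points C) ×-dec (p₃ ∈? points C)) ×-dec
    through? l₁ p₁ p₂ p₃ ×-dec through? l₂ p₂ p₃ p₁ ×-dec through? l₃ p₁ p₃ p₂

  monochromatic? : ∀ c → Decidable (Monochromatic c)
  monochromatic? c t = any? λ l₁ → any? λ l₂ → any? λ l₃ →
    triangleOn? t l₁ l₂ l₃ ×-dec
      ((lookup c l₁ ≟ᶜ lookup c l₂) ×-dec (lookup c l₂ ≟ᶜ lookup c l₃))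

-- An unordered triple of distinct points is represented by its unique
-- strictly increasing ordering.
Increasing : Triple N → Set
Increasing (p , q , r) = p < q × q < r

increasing? : Decidable (Increasing {N})
increasing? (p , q , r) = (p <? q) ×-dec (q <? r)

allTriples : ∀ N → List (Triple N)
allTriples N = cartesianProduct (allFin N) (cartesianProduct (allFin N) (allFin N))

monochromaticTriangles : PointLineSystem N m → Colouring m → ℕ
monochromaticTriangles {N} C c = List.length (List.filter
  (λ t → increasing? t ×-dec monochromatic? C c t) (allTriples N))

colours : List Colour
colours = red List.∷ blue List.∷ List.[]

allColourings : ∀ m → List (Colouring m)
allColourings ℕ.zero    = List.[ [] ]
allColourings (ℕ.suc m) =
  cartesianProductWith _∷_ colours (allColourings m)

-- The all-red colouring is only the default element that argmin requires.
bestColouring : PointLineSystem N m → Colouring m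
bestColouring {m = m} C =
  argmin (monochromaticTriangles C) (replicate m red) (allColourings m)

minMonochromaticTriangles : PointLineSystem N m → ℕ
minMonochromaticTriangles C = monochromaticTriangles C (bestColouring C)

allColourings-complete : ∀ {m} (c : Colouring m) → c ∈ˡ allColourings m
allColourings-complete []         = here refl
allColourings-complete (red ∷ c)  =
  ∈-cartesianProductWith⁺ _∷_ {xs = colours} (here refl) (allColourings-complete c)
allColourings-complete (blue ∷ c) =
  ∈-cartesianProductWith⁺ _∷_ {xs = colours} (there (here refl)) (allColourings-complete c)

minMonochromaticTriangles-≤ : (C : PointLineSystem N m) (c : Colouring m) →
  minMonochromaticTriangles C ≤ monochromaticTriangles C c
minMonochromaticTriangles-≤ {m = m} C c =
  All.lookup (f[argmin]≤f[xs] (replicate m red) (allColourings m))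
             (allColourings-complete c)

{-# OPTIONS --safe #-}
module Submission where

open import Defs
open import Data.Nat using (ℕ; _+_; _≤_; z≤n; s≤s)
open import Data.Nat.Properties using (m≤n⇒m≤1+n; +-suc; ≤-trans; ≤-reflexive)
open import Data.Fin using (Fin; _↑ˡ_; _↑ʳ_; splitAt)
open import Data.Fin.Properties using (_≟_; splitAt⁻¹-↑ˡ; splitAt⁻¹-↑ʳ)
open import Data.Fin.Subset using (Subset; inside; outside; _∈_; _∉_; _∩_; _∪_; _─_; _-_; ⁅_⁆; Empty)
open import Data.Fin.Subset.Properties
  using (x∈p∩q⁺; x∈p∪q⁻; x∈⁅y⁆⇒x≡y; x∈⁅x⁆; p─q⊆p)
open import Data.List using ([]; _∷_; length; filter)
open import Data.Product using (_×_; _,_; ∃-syntax)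
open import Data.Sum using (_⊎_; inj₁; inj₂)
open import Data.Vec using (Vec; _∷_; there; lookup; _++_; _[_]≔_)
open import Data.Vec.Properties using (lookup∘update; lookup∘update′; lookup-++ˡ; lookup-++ʳ)
open import Function using (_∘_)
open import Relation.Binary.PropositionalEquality
  using (_≡_; _≢_; refl; sym; trans; subst)
open import Relation.Nullary using (yes; no; contradiction; _×-dec_)
open import Relation.Unary using (Pred; Decidable)

-- The only lines of the connected sum meeting both point sets are the two
-- exchanged ones: the first joins p₂ to points other than p₁, the second joins p₁
-- to points other than p₂, so no point lies on connections of both kinds to the
-- other side.  In a triangle with vertices on both sides, the two sides at the
-- lone vertex would thus be the same line: there is no such triangle.  A triangle
-- inside one summand is a triangle of that summand, on the same lines.  So the
-- concatenation of optimal colourings has no monochromatic triangles besides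
-- those already present in the summands.

-- This turns a case analysis on single triangles into a bound on counts. An element satisfying both
-- `Q` and `R` is counted twice on the right, hence an inequality.
length-filter-⊎ : ∀ {a p q r} {A : Set a} {P : Pred A p} {Q : Pred A q} {R : Pred A r}
  (P? : Decidable P) (Q? : Decidable Q) (R? : Decidable R) →
  (∀ {x} → P x → Q x ⊎ R x) → ∀ xs →
  length (filter P? xs) ≤ length (filter Q? xs) + length (filter R? xs)
length-filter-⊎ P? Q? R? P⇒Q⊎R [] = z≤n
length-filter-⊎ P? Q? R? P⇒Q⊎R (x ∷ xs)
  with P? x | Q? x | R? x | length-filter-⊎ P? Q? R? P⇒Q⊎R xs
... | no  _  | no  _  | no  _  | ih = ih
... | no  _  | no  _  | yes _  | ih = ≤-trans (m≤n⇒m≤1+n ih) (≤-reflexive (sym (+-suc _ _)))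
... | no  _  | yes _  | no  _  | ih = m≤n⇒m≤1+n ih
... | no  _  | yes _  | yes _  | ih =
  m≤n⇒m≤1+n (≤-trans (m≤n⇒m≤1+n ih) (≤-reflexive (sym (+-suc _ _))))
... | yes _  | yes _  | no  _  | ih = s≤s ih
... | yes _  | yes _  | yes _  | ih =
  s≤s (≤-trans (m≤n⇒m≤1+n ih) (≤-reflexive (sym (+-suc _ _))))
... | yes _  | no  _  | yes _  | ih = ≤-trans (s≤s ih) (≤-reflexive (sym (+-suc _ _)))
... | yes px | no ¬qx | no ¬rx | _  with P⇒Q⊎R px
...   | inj₁ qx = contradiction qx ¬qx
...   | inj₂ rx = contradiction rx ¬rx

x∈p─q⇒x∉q : ∀ {n} {x : Fin n} (p q : Subset n) → x ∈ p ─ q → x ∉ q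
x∈p─q⇒x∉q (_ ∷ p) (outside ∷ q) (there x∈p─q) (there x∈q) = x∈p─q⇒x∉q p q x∈p─q x∈q
x∈p─q⇒x∉q (_ ∷ p) (inside ∷ q)  (there x∈p─q) (there x∈q) = x∈p─q⇒x∉q p q x∈p─q x∈q

x∈p-y⇒x≢y : ∀ {n} {x : Fin n} (p : Subset n) y → x ∈ p - y → x ≢ y
x∈p-y⇒x≢y p y x∈p-y refl = x∈p─q⇒x∉q p ⁅ y ⁆ x∈p-y (x∈⁅x⁆ y)

-- As a view, it lets a match replace the index itself by `j ↑ˡ n` or `m ↑ʳ j` in every incidence
-- that mentions it.
data SplitView {m n : ℕ} : Fin (m + n) → Set where
  left  : (j : Fin m) → SplitView (j ↑ˡ n)
  right : (j : Fin n) → SplitView (m ↑ʳ j)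

splitView : ∀ m {n} (i : Fin (m + n)) → SplitView {m} {n} i
splitView m i with splitAt m i in eq
... | inj₁ j = subst SplitView (splitAt⁻¹-↑ˡ eq) (left j)
... | inj₂ j = subst SplitView (splitAt⁻¹-↑ʳ {m} eq) (right j)

Linear : ∀ {N m} → PointLineSystem N m → Set
Linear C = ∀ {p q} → p ≢ q → ∀ {i j} →
  p ∈ line C i → q ∈ line C i → p ∈ line C j → q ∈ line C j → i ≡ j

∈∉⇒≢ : ∀ {n} {x y : Fin n} {p : Subset n} → x ∈ p → y ∉ p → x ≢ y
∈∉⇒≢ x∈p y∉p refl = y∉p x∈p

-- Non-incidences need not be assumed to transfer: if the third vertex were on
-- the line of C through the other two, two sides of the triangle would coincide.
monochromatic-restrict : ∀ {N m m′} (C : PointLineSystem N m) (D : PointLineSystem N m′)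
  (f : Fin m → Fin m′) (c : Colouring m) (d : Colouring m′) →
  (∀ j → lookup d (f j) ≡ lookup c j) →
  Linear C →
  (∀ {u v} → u ≢ v → u ∈ points C → v ∈ points C →
    ∀ i → u ∈ line D i → v ∈ line D i → ∃[ j ] i ≡ f j × u ∈ line C j × v ∈ line C j) →
  ∀ {p q r} → p ∈ points C → q ∈ points C → r ∈ points C →
  Monochromatic D d (p , q , r) → Monochromatic C c (p , q , r)
monochromatic-restrict C D f c d d∘f≡c linear lift {p} {q} {r} p∈C q∈C r∈C
  (i₁ , i₂ , i₃ , (_ , (p∈i₁ , q∈i₁ , r∉i₁) , (q∈i₂ , r∈i₂ , p∉i₂) , (p∈i₃ , r∈i₃ , q∉i₃)) , (c₁₂ , c₂₃))
  -- Distinctness of the vertices is read off the triangle: for any two of them, some side contains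
  -- one and misses the other.
  with lift (∈∉⇒≢ p∈i₃ q∉i₃) p∈C q∈C i₁ p∈i₁ q∈i₁
     | lift (∈∉⇒≢ q∈i₁ r∉i₁) q∈C r∈C i₂ q∈i₂ r∈i₂
     | lift (∈∉⇒≢ p∈i₁ r∉i₁) p∈C r∈C i₃ p∈i₃ r∈i₃
... | j₁ , refl , p∈j₁ , q∈j₁ | j₂ , refl , q∈j₂ , r∈j₂ | j₃ , refl , p∈j₃ , r∈j₃ =
  j₁ , j₂ , j₃ ,
  ((p∈C , q∈C , r∈C) ,
   (p∈j₁ , q∈j₁ , λ r∈j₁ → p∉i₂ (along (linear q≢r q∈j₁ r∈j₁ q∈j₂ r∈j₂) p∈i₁)) ,
   (q∈j₂ , r∈j₂ , λ p∈j₂ → q∉i₃ (along (linear p≢r p∈j₂ r∈j₂ p∈j₃ r∈j₃) q∈i₂)) ,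
   (p∈j₃ , r∈j₃ , λ q∈j₃ → r∉i₁ (along (linear p≢q p∈j₃ q∈j₃ p∈j₁ q∈j₁) r∈i₃))) ,
  (trans (sym (d∘f≡c j₁)) (trans c₁₂ (d∘f≡c j₂)) ,
   trans (sym (d∘f≡c j₂)) (trans c₂₃ (d∘f≡c j₃)))
  where
  p≢q = ∈∉⇒≢ p∈i₃ q∉i₃
  q≢r = ∈∉⇒≢ q∈i₁ r∉i₁
  p≢r = ∈∉⇒≢ p∈i₁ r∉i₁
  along : ∀ {x j j′} → j ≡ j′ → x ∈ line D (f j) → x ∈ line D (f j′)
  along {x} = subst (λ j → x ∈ line D (f j))

-- Spelled like the halves of `connectedSum`, whose line vector is thus by definition a
-- concatenation of two exchanges.
exchange : ∀ {N m} → PointLineSystem N m → Fin m → Fin N → Fin N → Vec (Subset N) m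
exchange C l p p′ = lines C [ l ]≔ ((line C l - p) ∪ ⁅ p′ ⁆)

module Exchange {N m} (C : PointLineSystem N m) (l : Fin m) (p p′ : Fin N) where

  -- The clause `j ≡ l → x ≢ p` records the removal of `p`, which later tells the two kinds of
  -- connection between the sides apart.
  ∈-exchange⁻ : ∀ {x} j → x ∈ lookup (exchange C l p p′) j →
    (x ∈ line C j × (j ≡ l → x ≢ p)) ⊎ (j ≡ l × x ≡ p′)
  ∈-exchange⁻ {x} j x∈ with j ≟ l
  ... | no j≢l =
    inj₁ (subst (x ∈_) (lookup∘update′ j≢l (lines C) _) x∈ , λ j≡l → contradiction j≡l j≢l)
  ... | yes refl
    with x∈p∪q⁻ (line C j - p) ⁅ p′ ⁆ (subst (x ∈_) (lookup∘update j (lines C) _) x∈)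
  ...   | inj₁ x∈l-p = inj₁ (p─q⊆p (line C j) ⁅ p ⁆ x∈l-p , λ _ → x∈p-y⇒x≢y (line C j) p x∈l-p)
  ...   | inj₂ x∈p′  = inj₂ (refl , x∈⁅y⁆⇒x≡y p′ x∈p′)

  own : p′ ∉ points C → ∀ {x} j → x ∈ points C → x ∈ lookup (exchange C l p p′) j →
    x ∈ line C j × (j ≡ l → x ≢ p)
  own p′∉C j x∈C x∈ with ∈-exchange⁻ j x∈
  ... | inj₁ old        = old
  ... | inj₂ (_ , refl) = contradiction x∈C p′∉C

  foreign : (∀ {x} j → x ∈ line C j → x ∈ points C) →
    ∀ {x} j → x ∉ points C → x ∈ lookup (exchange C l p p′) j → j ≡ l × x ≡ p′
  foreign lines⊆C j x∉C x∈ with ∈-exchange⁻ j x∈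
  ... | inj₁ (x∈j , _) = contradiction (lines⊆C j x∈j) x∉C
  ... | inj₂ new       = new

module Sum {N n s m k : ℕ} (C₁ C₂ : PointLineSystem N m)
  (conf₁ : IsConfiguration n s m k C₁) (conf₂ : IsConfiguration n s m k C₂)
  (disjoint : Empty (points C₁ ∩ points C₂))
  (p₁ : Fin N) (l₁ : Fin m) (p₁∈l₁ : p₁ ∈ line C₁ l₁)
  (p₂ : Fin N) (l₂ : Fin m) (p₂∈l₂ : p₂ ∈ line C₂ l₂) where

  private
    module I₁ = IsConfiguration conf₁
    module I₂ = IsConfiguration conf₂
    module E₁ = Exchange C₁ l₁ p₁ p₂
    module E₂ = Exchange C₂ l₂ p₂ p₁

  S : PointLineSystem N (m + m)
  S = connectedSum C₁ p₁ l₁ C₂ p₂ l₂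

  ∉₂ : ∀ {x} → x ∈ points C₁ → x ∉ points C₂
  ∉₂ x∈C₁ x∈C₂ = disjoint (_ , x∈p∩q⁺ (x∈C₁ , x∈C₂))

  ∉₁ : ∀ {x} → x ∈ points C₂ → x ∉ points C₁
  ∉₁ x∈C₂ x∈C₁ = ∉₂ x∈C₁ x∈C₂

  ∈left : ∀ {x} j → x ∈ line S (j ↑ˡ m) → x ∈ lookup (exchange C₁ l₁ p₁ p₂) j
  ∈left {x} j = subst (x ∈_) (lookup-++ˡ (exchange C₁ l₁ p₁ p₂) _ j)

  ∈right : ∀ {x} j → x ∈ line S (m ↑ʳ j) → x ∈ lookup (exchange C₂ l₂ p₂ p₁) j
  ∈right {x} j = subst (x ∈_) (lookup-++ʳ (exchange C₁ l₁ p₁ p₂) _ j)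

  own₁ : ∀ {x} j → x ∈ points C₁ → x ∈ line S (j ↑ˡ m) → x ∈ line C₁ j × (j ≡ l₁ → x ≢ p₁)
  own₁ j x∈C₁ = E₁.own (∉₁ (I₂.lines⊆points l₂ p₂∈l₂)) j x∈C₁ ∘ ∈left j

  own₂ : ∀ {x} j → x ∈ points C₂ → x ∈ line S (m ↑ʳ j) → x ∈ line C₂ j × (j ≡ l₂ → x ≢ p₂)
  own₂ j x∈C₂ = E₂.own (∉₂ (I₁.lines⊆points l₁ p₁∈l₁)) j x∈C₂ ∘ ∈right j

  foreign₁ : ∀ {x} j → x ∈ points C₁ → x ∈ line S (m ↑ʳ j) → j ≡ l₂ × x ≡ p₁
  foreign₁ j x∈C₁ = E₂.foreign (λ j → I₂.lines⊆points j) j (∉₂ x∈C₁) ∘ ∈right j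

  foreign₂ : ∀ {x} j → x ∈ points C₂ → x ∈ line S (j ↑ˡ m) → j ≡ l₁ × x ≡ p₂
  foreign₂ j x∈C₂ = E₁.foreign (λ j → I₁.lines⊆points j) j (∉₁ x∈C₂) ∘ ∈left j

  -- A line from the second half carries at most one point of `C₁`, namely `p₁`, so two distinct
  -- points of `C₁` force the first half.
  lift₁ : ∀ {u v} → u ≢ v → u ∈ points C₁ → v ∈ points C₁ →
    ∀ i → u ∈ line S i → v ∈ line S i → ∃[ j ] i ≡ j ↑ˡ m × u ∈ line C₁ j × v ∈ line C₁ j
  lift₁ u≢v u∈C v∈C i u∈i v∈i with splitView m i
  ... | left j with own₁ j u∈C u∈i | own₁ j v∈C v∈i
  ...   | u∈j , _ | v∈j , _ = j , refl , u∈j , v∈j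
  lift₁ u≢v u∈C v∈C i u∈i v∈i | right j with foreign₁ j u∈C u∈i | foreign₁ j v∈C v∈i
  ...   | _ , u≡p₁ | _ , v≡p₁ = contradiction (trans u≡p₁ (sym v≡p₁)) u≢v

  lift₂ : ∀ {u v} → u ≢ v → u ∈ points C₂ → v ∈ points C₂ →
    ∀ i → u ∈ line S i → v ∈ line S i → ∃[ j ] i ≡ m ↑ʳ j × u ∈ line C₂ j × v ∈ line C₂ j
  lift₂ u≢v u∈C v∈C i u∈i v∈i with splitView m i
  ... | right j with own₂ j u∈C u∈i | own₂ j v∈C v∈i
  ...   | u∈j , _ | v∈j , _ = j , refl , u∈j , v∈j
  lift₂ u≢v u∈C v∈C i u∈i v∈i | left j with foreign₂ j u∈C u∈i | foreign₂ j v∈C v∈i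
  ...   | _ , u≡p₂ | _ , v≡p₂ = contradiction (trans u≡p₂ (sym v≡p₂)) u≢v

  -- The alternatives disagree both on whether `a` is `p₁` and on whether `x` is `p₂`, so either
  -- endpoint alone determines the line.
  bridge : ∀ {a x} → a ∈ points C₁ → x ∈ points C₂ → ∀ i → a ∈ line S i → x ∈ line S i →
    (i ≡ l₁ ↑ˡ m × a ≢ p₁ × x ≡ p₂) ⊎ (i ≡ m ↑ʳ l₂ × a ≡ p₁ × x ≢ p₂)
  bridge a∈C₁ x∈C₂ i a∈i x∈i with splitView m i
  ... | left j with own₁ j a∈C₁ a∈i | foreign₂ j x∈C₂ x∈i
  ...   | _ , a≢p₁ | refl , x≡p₂ = inj₁ (refl , a≢p₁ refl , x≡p₂)
  bridge a∈C₁ x∈C₂ i a∈i x∈i | right j with foreign₁ j a∈C₁ a∈i | own₂ j x∈C₂ x∈i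
  ...   | refl , a≡p₁ | _ , x≢p₂ = inj₂ (refl , a≡p₁ , x≢p₂ refl)

  -- Comparing `a` with `p₁` selects the same exchanged line for both connections.
  bridges-at₁ : ∀ {a x y i i′} → a ∈ points C₁ → x ∈ points C₂ → y ∈ points C₂ →
    a ∈ line S i → x ∈ line S i → a ∈ line S i′ → y ∈ line S i′ → i ≡ i′
  bridges-at₁ {i = i} {i′} a∈C₁ x∈C₂ y∈C₂ a∈i x∈i a∈i′ y∈i′
    with bridge a∈C₁ x∈C₂ i a∈i x∈i | bridge a∈C₁ y∈C₂ i′ a∈i′ y∈i′
  ... | inj₁ (i≡ , _)        | inj₁ (i′≡ , _)       = trans i≡ (sym i′≡)
  ... | inj₁ (_ , a≢p₁ , _)  | inj₂ (_ , a≡p₁ , _)  = contradiction a≡p₁ a≢p₁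
  ... | inj₂ (_ , a≡p₁ , _)  | inj₁ (_ , a≢p₁ , _)  = contradiction a≡p₁ a≢p₁
  ... | inj₂ (i≡ , _)        | inj₂ (i′≡ , _)       = trans i≡ (sym i′≡)

  -- Here the choice is made by comparing `x` with `p₂`.
  bridges-at₂ : ∀ {x a b i i′} → x ∈ points C₂ → a ∈ points C₁ → b ∈ points C₁ →
    x ∈ line S i → a ∈ line S i → x ∈ line S i′ → b ∈ line S i′ → i ≡ i′
  bridges-at₂ {i = i} {i′} x∈C₂ a∈C₁ b∈C₁ x∈i a∈i x∈i′ b∈i′
    with bridge a∈C₁ x∈C₂ i a∈i x∈i | bridge b∈C₁ x∈C₂ i′ b∈i′ x∈i′
  ... | inj₁ (i≡ , _)        | inj₁ (i′≡ , _)       = trans i≡ (sym i′≡)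
  ... | inj₁ (_ , _ , x≡p₂)  | inj₂ (_ , _ , x≢p₂)  = contradiction x≡p₂ x≢p₂
  ... | inj₂ (_ , _ , x≢p₂)  | inj₁ (_ , _ , x≡p₂)  = contradiction x≡p₂ x≢p₂
  ... | inj₂ (i≡ , _)        | inj₂ (i′≡ , _)       = trans i≡ (sym i′≡)

  monochromatic-split : (c₁ c₂ : Colouring m) {t : Triple N} →
    Monochromatic S (c₁ ++ c₂) t → Monochromatic C₁ c₁ t ⊎ Monochromatic C₂ c₂ t
  monochromatic-split c₁ c₂ {p , q , r}
    mono@(i₁ , i₂ , i₃ ,
      ((p∈S , q∈S , r∈S) , (p∈i₁ , q∈i₁ , r∉i₁) , (q∈i₂ , r∈i₂ , p∉i₂) , (p∈i₃ , r∈i₃ , q∉i₃)) , _)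
    with ∈S⁻ p∈S | ∈S⁻ q∈S | ∈S⁻ r∈S
    where
    ∈S⁻ : ∀ {x} → x ∈ points S → x ∈ points C₁ ⊎ x ∈ points C₂
    ∈S⁻ = x∈p∪q⁻ (points C₁) (points C₂)
  ... | inj₁ p∈₁ | inj₁ q∈₁ | inj₁ r∈₁ =
    inj₁ (monochromatic-restrict C₁ S (_↑ˡ m) c₁ (c₁ ++ c₂) (lookup-++ˡ c₁ c₂)
      I₁.linear lift₁ p∈₁ q∈₁ r∈₁ mono)
  ... | inj₂ p∈₂ | inj₂ q∈₂ | inj₂ r∈₂ =
    inj₂ (monochromatic-restrict C₂ S (m ↑ʳ_) c₂ (c₁ ++ c₂) (lookup-++ʳ c₁ c₂)
      I₂.linear lift₂ p∈₂ q∈₂ r∈₂ mono)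
  -- The mixed cases come in pairs by lone vertex: `p` with sides `i₁`, `i₃`, then `q` with `i₁`,
  -- `i₂`, then `r` with `i₂`, `i₃`. Identifying the two sides puts a vertex on a side that avoids
  -- it.
  ... | inj₁ p∈₁ | inj₂ q∈₂ | inj₂ r∈₂ with refl ← bridges-at₁ p∈₁ q∈₂ r∈₂ p∈i₁ q∈i₁ p∈i₃ r∈i₃ =
    contradiction q∈i₁ q∉i₃
  ... | inj₂ p∈₂ | inj₁ q∈₁ | inj₁ r∈₁ with refl ← bridges-at₂ p∈₂ q∈₁ r∈₁ p∈i₁ q∈i₁ p∈i₃ r∈i₃ =
    contradiction q∈i₁ q∉i₃
  ... | inj₂ p∈₂ | inj₁ q∈₁ | inj₂ r∈₂ with refl ← bridges-at₁ q∈₁ p∈₂ r∈₂ q∈i₁ p∈i₁ q∈i₂ r∈i₂ =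
    contradiction p∈i₁ p∉i₂
  ... | inj₁ p∈₁ | inj₂ q∈₂ | inj₁ r∈₁ with refl ← bridges-at₂ q∈₂ p∈₁ r∈₁ q∈i₁ p∈i₁ q∈i₂ r∈i₂ =
    contradiction p∈i₁ p∉i₂
  ... | inj₂ p∈₂ | inj₂ q∈₂ | inj₁ r∈₁ with refl ← bridges-at₁ r∈₁ q∈₂ p∈₂ r∈i₂ q∈i₂ r∈i₃ p∈i₃ =
    contradiction q∈i₂ q∉i₃
  ... | inj₁ p∈₁ | inj₁ q∈₁ | inj₂ r∈₂ with refl ← bridges-at₂ r∈₂ q∈₁ p∈₁ r∈i₂ q∈i₂ r∈i₃ p∈i₃ =
    contradiction q∈i₂ q∉i₃

  -- All three systems live in the same `Fin N`, so the three counts filter one list,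
  -- `allTriples N`, and compare triple by triple.
  monochromaticTriangles-++ : (c₁ c₂ : Colouring m) →
    monochromaticTriangles (connectedSum C₁ p₁ l₁ C₂ p₂ l₂) (c₁ ++ c₂)
      ≤ monochromaticTriangles C₁ c₁ + monochromaticTriangles C₂ c₂
  monochromaticTriangles-++ c₁ c₂ = length-filter-⊎
    (λ t → increasing? t ×-dec monochromatic? (connectedSum C₁ p₁ l₁ C₂ p₂ l₂) (c₁ ++ c₂) t)
    (λ t → increasing? t ×-dec monochromatic? C₁ c₁ t)
    (λ t → increasing? t ×-dec monochromatic? C₂ c₂ t)
    split (allTriples N)
    where
    split : ∀ {t} → Increasing t × Monochromatic (connectedSum C₁ p₁ l₁ C₂ p₂ l₂) (c₁ ++ c₂) t →
      (Increasing t × Monochromatic C₁ c₁ t) ⊎ (Increasing t × Monochromatic C₂ c₂ t)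
    split {t} (inc , mono) with monochromatic-split c₁ c₂ {t} mono
    ... | inj₁ mono₁ = inj₁ (inc , mono₁)
    ... | inj₂ mono₂ = inj₂ (inc , mono₂)

corollary5p3 : ∀ {N n s m k : ℕ} (C₁ C₂ : PointLineSystem N m) →
    IsConfiguration n s m k C₁ →
    IsConfiguration n s m k C₂ →
    Empty (points C₁ ∩ points C₂) →
    (p₁ : Fin N) (l₁ : Fin m) → p₁ ∈ line C₁ l₁ →
    (p₂ : Fin N) (l₂ : Fin m) → p₂ ∈ line C₂ l₂ →
    minMonochromaticTriangles (connectedSum C₁ p₁ l₁ C₂ p₂ l₂)
    ≤ minMonochromaticTriangles C₁ + minMonochromaticTriangles C₂
corollary5p3 C₁ C₂ conf₁ conf₂ disjoint p₁ l₁ p₁∈l₁ p₂ l₂ p₂∈l₂ =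
  ≤-trans
    -- The right-hand side is by definition the sum of the counts at the two best colourings; their
    -- concatenation is one candidate for the minimum on the left.
    (minMonochromaticTriangles-≤ (connectedSum C₁ p₁ l₁ C₂ p₂ l₂) (bestColouring C₁ ++ bestColouring C₂))
    (Sum.monochromaticTriangles-++ C₁ C₂ conf₁ conf₂ disjoint p₁ l₁ p₁∈l₁ p₂ l₂ p₂∈l₂
      (bestColouring C₁) (bestColouring C₂))
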